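{- For all integers $\alpha\ge2$, $0\le m\le\alpha$ and $n\in\mathbb Z$, $$C_{\alpha,m,n}=C_{\alpha-1,m,n}+y_{2\alpha-1,n}\,C_{\alpha-1,m-1,n}+y_{2\alpha-2,n}\,C_{\alpha-2,m-1,n}.$$ Moreover $C_{\alpha,0,n}=1$ for all $\alpha\ge0$.
   Context: Let $(r_{1,n})_{n\in\mathbb Z}$ be a sequence in a field $K$, set $r_{0,n}=1$ and $r_{\alpha,n}=\det_{1\le i,j\le\alpha}(r_{1,n+i+j-1-\alpha})$ for $\alpha\ge1$, and assume all $r_{\alpha,n}$ are nonzero. For $p\ge0$ let $s_p(j)=j$ if $j\le p$ and $s_p(j)=j+1$ if $j>p$; for $\alpha\ge1$, $0\le m\le \alpha$ let $c_{\alpha,m,n}=\det_{1\le i,j\le\alpha}(r_{1,n+i+s_{\alpha-m}(j)-\alpha-1})$, $c_{0,0,n}=1$, and $c_{\alpha,m,n}=0$ if $m<0$ or $m>\alpha$. Define $v_{\alpha,n}=r_{\alpha,n}/r_{\alpha-1,n}$ ($\alpha\ge1$), the weights $$y_{2\alpha-1,n}=\frac{v_{\alpha,n+1}}{v_{\alpha,n}}=\frac{r_{\alpha-1,n}r_{\alpha,n+1}}{r_{\alpha,n}r_{\alpha-1,n+1}},\qquad y_{2\alpha,n}=\frac{v_{\alpha+1,n+1}}{v_{\alpha,n}}=\frac{r_{\alpha-1,n}r_{\alpha+1,n+1}}{r_{\alpha,n}r_{\alpha,n+1}}\quad(\alpha\ge1),$$ and $C_{\alpha,m,n}=c_{\alpha,m,n}/(v_{1,n}v_{2,n}\cdots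 v_{\alpha,n})$ (with $C_{0,0,n}=1$ and $C_{\alpha,m,n}=0$ if $m<0$ or $m>\alpha$). -}

module Defs where

open import Algebra.Bundles using (CommutativeRing)
open import Algebra.Apartness.Bundles using (HeytingField; HeytingCommutativeRing)
open import Data.Bool.Base using (if_then_else_)
open import Data.Fin.Base using (Fin; zero; suc; toℕ; punchIn)
open import Data.Integer.Base as ℤ using (ℤ; +_; -[1+_]; 1ℤ)
open import Data.Nat.Base as ℕ using (ℕ; zero; suc; NonZero; _∸_; _≤ᵇ_)
open import Data.Product.Base using (_,_; proj₁; proj₂)
import Algebra.Apartness.Properties.HeytingCommutativeRing as HCRProperties
import Algebra.Properties.Semiring.Exp as SemiringExp
import Algebra.Properties.Semiring.Sum as SemiringSum

module Determinant {c ℓ} (R : CommutativeRing c ℓ) where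
  open CommutativeRing R hiding (zero)
  open SemiringExp semiring using (_^_)
  open SemiringSum semiring using (sum)

  -- Laplace expansion along the first row.
  det : ∀ {k} → (Fin k → Fin k → Carrier) → Carrier
  det {zero}  M = 1#
  det {suc k} M = sum λ j →
    (- 1#) ^ toℕ j * M zero j * det (λ i l → M (suc i) (punchIn j l))

-- A field is a Heyting field, "nonzero" is x # 0#, and division takes the proof
-- that the denominator is nonzero.
module Division {c ℓ₁ ℓ₂} (K : HeytingField c ℓ₁ ℓ₂) where
  open HeytingField K hiding (zero)
  open HCRProperties heytingCommutativeRing
    using (x-0≈x; invertibleʳ⇒#; x#0y#0→xy#0)

  -- #⇒invertible inverts x - 0#, which is ≈ x.
  inverse : (x : Carrier) → x # 0# → Carrier
  inverse x x#0 = proj₁ (#⇒invertible x#0)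

  infixl 7 _/_[_]

  _/_[_] : Carrier → (y : Carrier) → y # 0# → Carrier
  x / y [ y#0 ] = x * inverse y y#0

  inverse#0 : ∀ x (x#0 : x # 0#) → inverse x x#0 # 0#
  inverse#0 x x#0 = invertibleʳ⇒#
    ( x - 0#
    , trans (*-congʳ (x-0≈x (inverse x x#0))) (proj₁ (proj₂ (#⇒invertible x#0)))
    )

  /#0 : ∀ {x y} → x # 0# → (y#0 : y # 0#) → (x / y [ y#0 ]) # 0#
  /#0 {y = y} x#0 y#0 = x#0y#0→xy#0 x#0 (inverse#0 y y#0)

s : ℕ → ℕ → ℕ
s p j = if j ≤ᵇ p then j else suc j

module Hankel {k ℓ₁ ℓ₂} (K : HeytingField k ℓ₁ ℓ₂)
              (r₁ : ℤ → HeytingField.Carrier K) where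
  open HeytingField K hiding (zero)
  open Determinant (HeytingCommutativeRing.commutativeRing heytingCommutativeRing)

  -- The 1-based row or column number of an element of Fin k.
  ♯ : ∀ {k} → Fin k → ℕ
  ♯ i = suc (toℕ i)

  r : ℕ → ℤ → Carrier
  r zero      n = 1#
  r α@(suc _) n = det {α} λ i j →
    r₁ (n ℤ.+ + ♯ i ℤ.+ + ♯ j ℤ.- 1ℤ ℤ.- + α)

  -- The empty determinant is 1#, so c 0 (+ 0) n is 1#.
  c : ℕ → ℤ → ℤ → Carrier
  c α -[1+ _ ] n = 0#
  c α (+ m)    n = if m ≤ᵇ α
    then det {α} (λ i j → r₁ (n ℤ.+ + ♯ i ℤ.+ + s (α ∸ m) (♯ j) ℤ.- + α ℤ.- 1ℤ))
    else 0#

  AllNonzero : Set ℓ₂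
  AllNonzero = ∀ α n → r α n # 0#

module Weights {k ℓ₁ ℓ₂} (K : HeytingField k ℓ₁ ℓ₂)
               (r₁ : ℤ → HeytingField.Carrier K)
               (r#0 : Hankel.AllNonzero K r₁) where
  open HeytingField K hiding (zero)
  open Hankel K r₁
  open Division K
  open HCRProperties heytingCommutativeRing using (1#0; x#0y#0→xy#0)

  v : (α : ℕ) .{{_ : NonZero α}} → ℤ → Carrier
  v α n = r α n / r (α ∸ 1) n [ r#0 (α ∸ 1) n ]

  v#0 : (α : ℕ) .{{_ : NonZero α}} (n : ℤ) → v α n # 0#
  v#0 α n = /#0 (r#0 α n) (r#0 (α ∸ 1) n)

  -- yOdd α is the weight with index 2α - 1.
  yOdd : (α : ℕ) .{{_ : NonZero α}} → ℤ → Carrier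
  yOdd α n = v α (n ℤ.+ 1ℤ) / v α n [ v#0 α n ]

  -- yEven α is the weight with index 2α.
  yEven : (α : ℕ) .{{_ : NonZero α}} → ℤ → Carrier
  yEven α n = v (suc α) (n ℤ.+ 1ℤ) / v α n [ v#0 α n ]

  -- v 1 n * v 2 n * … * v α n
  ∏v : ℕ → ℤ → Carrier
  ∏v zero    n = 1#
  ∏v (suc α) n = ∏v α n * v (suc α) n

  ∏v#0 : ∀ α n → ∏v α n # 0#
  ∏v#0 zero    n = 1#0
  ∏v#0 (suc α) n = x#0y#0→xy#0 (∏v#0 α n) (v#0 (suc α) n)

  C : ℕ → ℤ → ℤ → Carrier
  C α m n = c α m n / ∏v α n [ ∏v#0 α n ]

{-# OPTIONS --safe #-}
module Submission where

-- The product v₁ ⋯ v_α telescopes to r_α, so the C_{α,m,n} are, up to sign, the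
-- coefficients of a monic polynomial P_α, namely a bordered Hankel determinant divided
-- by r_{α,n}.  Under the functional L : x^t ↦ r_{1,t}, P_α is orthogonal to the α powers
-- x^(n+1-α), …, x^n.  The recurrence says
--   P_α = (x − y_{2α-1}) P_{α-1} − y_{2α-2} x P_{α-2}.
-- The difference of the two sides has degree < α, is orthogonal to x^(n+2-α), …, x^(n-1)
-- automatically, and to the two extreme powers by the choice of the weights: there the
-- values of L are again Hankel determinants.  As the Hankel matrix of these α powers has
-- determinant r_{α,n} ≠ 0 and is symmetric, the difference vanishes.

open import Defs
open import Algebra.Apartness.Bundles using (HeytingField; HeytingCommutativeRing)
open import Algebra.Bundles using (CommutativeRing)
open import Data.Fin.Base using (Fin; zero; suc; toℕ; punchIn; fromℕ; fromℕ<; inject₁)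
open import Data.Fin.Properties using (toℕ-fromℕ; toℕ-fromℕ<; toℕ-inject₁)
open import Data.Fin.Relation.Unary.Top using (view; ‵fromℕ; ‵inject₁)
open import Data.Bool.Base using (true; false)
open import Data.Bool.Properties using (T-≡; if-float)
open import Data.Integer.Base as ℤ using (ℤ; +_; 1ℤ)
open import Data.Integer.Properties as ℤ using ()
open import Data.Integer.Solver as ℤ using ()
open import Data.Nat.Base as ℕ using (ℕ; zero; suc; _∸_; _≤_)
open import Data.Nat.Properties as ℕ using ()
open import Data.Product.Base using (_×_; _,_; proj₂; ∃-syntax)
open import Data.Vec.Functional using (_∷_; init; tail; removeAt)
open import Function.Base using (_∘_)
open import Function.Bundles using (Equivalence)
open import Relation.Binary.PropositionalEquality as ≡ using (_≡_; _≗_)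
open import Relation.Nullary.Negation using (contradiction)
import Algebra.Apartness.Properties.HeytingCommutativeRing as HCRProperties
import Algebra.Properties.CommutativeSemigroup as CommutativeSemigroupProperties
import Algebra.Properties.Ring as RingProperties
import Algebra.Properties.Semiring.Exp as SemiringExp
import Algebra.Properties.Semiring.Sum as SemiringSum
import Algebra.Solver.Ring.NaturalCoefficients.Default as Solver
import Relation.Binary.Reasoning.Setoid as SetoidReasoning

-- Determinants over a commutative ring: alternation, linearity in rows, Cramer's rule.

module DeterminantProperties {c ℓ} (R : CommutativeRing c ℓ) where
  open CommutativeRing R hiding (zero)
  open Determinant R
  open RingProperties ring using (-1*x≈-x)
  open SemiringExp semiring using (_^_)
  open SemiringSum semiring
  open SetoidReasoning setoid
  open Solver commutativeSemiring using (solve; _:+_; _:*_; _:=_)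

  -- Signs are powers of one constant, so that identities between signed products can be left to the
  -- commutative semiring solver, which treats `ε` as a variable.
  ε : Carrier
  ε = - 1#

  x+εx≈0 : ∀ x → x + ε * x ≈ 0#
  x+εx≈0 x = trans (+-congˡ (-1*x≈-x x)) (-‿inverseʳ x)

  x+y≈0⇒x≈εy : ∀ {x y} → x + y ≈ 0# → x ≈ ε * y
  x+y≈0⇒x≈εy {x} {y} x+y≈0 = begin
    x                   ≈⟨ +-identityʳ x ⟨
    x + 0#              ≈⟨ +-congˡ (x+εx≈0 y) ⟨
    x + (y + ε * y)     ≈⟨ +-assoc x y (ε * y) ⟨
    x + y + ε * y       ≈⟨ +-congʳ x+y≈0 ⟩
    0# + ε * y          ≈⟨ +-identityˡ (ε * y) ⟩
    ε * y               ∎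

  ε*ε≈1 : ε * ε ≈ 1#
  ε*ε≈1 = sym (x+y≈0⇒x≈εy (-‿inverseʳ 1#))

  ε*εx≈x : ∀ x → ε * (ε * x) ≈ x
  ε*εx≈x x = trans (sym (*-assoc ε ε x)) (trans (*-congʳ ε*ε≈1) (*-identityˡ x))

  x+εy≈0⇒x≈y : ∀ {x y} → x + ε * y ≈ 0# → x ≈ y
  x+εy≈0⇒x≈y {y = y} eq = trans (x+y≈0⇒x≈εy eq) (ε*εx≈x y)

  ε^n*ε^n≈1 : ∀ n → ε ^ n * ε ^ n ≈ 1#
  ε^n*ε^n≈1 zero    = *-identityˡ 1#
  ε^n*ε^n≈1 (suc n) = begin
    ε * ε ^ n * (ε * ε ^ n)   ≈⟨ solve 2 (λ e x → e :* x :* (e :* x) := e :* e :* (x :* x)) refl ε (ε ^ n) ⟩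
    ε * ε * (ε ^ n * ε ^ n)   ≈⟨ *-cong ε*ε≈1 (ε^n*ε^n≈1 n) ⟩
    1# * 1#                   ≈⟨ *-identityˡ 1# ⟩
    1#                        ∎

  ε^n*x≈0⇒x≈0 : ∀ n {x} → ε ^ n * x ≈ 0# → x ≈ 0#
  ε^n*x≈0⇒x≈0 n {x} eq = begin
    x                     ≈⟨ *-identityˡ x ⟨
    1# * x                ≈⟨ *-congʳ (ε^n*ε^n≈1 n) ⟨
    ε ^ n * ε ^ n * x     ≈⟨ *-assoc _ _ x ⟩
    ε ^ n * (ε ^ n * x)   ≈⟨ *-congˡ eq ⟩
    ε ^ n * 0#            ≈⟨ zeroʳ _ ⟩
    0#                    ∎

  sum-zero : ∀ {n} {t : Fin n → Carrier} → (∀ i → t i ≈ 0#) → sum t ≈ 0#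
  sum-zero {n} t≈0 = trans (sum-cong-≋ t≈0) (sum-replicate-zero n)

  minor : ∀ {k} → (Fin k → Fin (suc k) → Carrier) → Fin (suc k) → Carrier
  minor N j = det λ i l → N i (punchIn j l)

  -- `sum (laplaceTerm a N)` is `det (a ∷ N)` by definition. Keeping the top row apart from the
  -- rectangular rest lets that row vary while the minors stay fixed.
  laplaceTerm : ∀ {k} → (Fin (suc k) → Carrier) → (Fin k → Fin (suc k) → Carrier) →
                Fin (suc k) → Carrier
  laplaceTerm a N j = ε ^ toℕ j * a j * minor N j

  det-cong : ∀ {k} {M N : Fin k → Fin k → Carrier} →
             (∀ i j → M i j ≈ N i j) → det M ≈ det N
  det-cong {zero}  M≈N = refl
  det-cong {suc k} {M} {N} M≈N = sum-cong-≋ {x = laplaceTerm (M zero) (tail M)} λ j →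
    *-cong (*-congˡ (M≈N zero j)) (det-cong λ i l → M≈N (suc i) (punchIn j l))

  -- W f stands for the minor on the columns f.  The terms indexed by (0 , l) and
  -- (suc l , 0) cancel, and the others form a sum of the same shape.
  alternatingSum≈0 : ∀ k (a : Fin (2 ℕ.+ k) → Carrier)
    (W : (Fin k → Fin (2 ℕ.+ k)) → Carrier) → (∀ {f g} → f ≗ g → W f ≈ W g) →
    sum (λ j → ε ^ toℕ j * a j *
      sum (λ l → ε ^ toℕ l * a (punchIn j l) * W (punchIn j ∘ punchIn l))) ≈ 0#
  alternatingSum≈0 k a W W-cong = begin
    1# * a zero * sum first + sum (λ j → ε * ε ^ toℕ j * a (suc j) * (1# * a zero * V j + sum (inner j)))
      ≈⟨ +-cong firstRow (sum-cong-≋ otherRow) ⟩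
    sum column + sum (λ j → ε * column j + rest j)
      ≈⟨ +-congˡ (trans (∑-distrib-+ (λ j → ε * column j) rest) (+-congʳ (sym (*-distribˡ-sum ε column)))) ⟩
    sum column + (ε * sum column + sum rest)
      ≈⟨ +-assoc _ _ _ ⟨
    sum column + ε * sum column + sum rest
      ≈⟨ +-cong (x+εx≈0 _) (rest≈0 k a W W-cong) ⟩
    0# + 0#
      ≈⟨ +-identityˡ 0# ⟩
    0# ∎
    where
    V : Fin (suc k) → Carrier
    V l = W (suc ∘ punchIn l)

    first column rest : Fin (suc k) → Carrier
    first l = ε ^ toℕ l * a (suc l) * V l
    column l = 1# * a zero * first l

    innerOf : ∀ {k} (a : Fin (2 ℕ.+ k) → Carrier) (W : (Fin k → Fin (2 ℕ.+ k)) → Carrier) →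
              Fin (suc k) → Fin k → Carrier
    innerOf a W j l = ε * ε ^ toℕ l * a (suc (punchIn j l)) * W (punchIn (suc j) ∘ punchIn (suc l))

    inner : Fin (suc k) → Fin k → Carrier
    inner = innerOf a W

    restOf : ∀ {k} (a : Fin (2 ℕ.+ k) → Carrier) (W : (Fin k → Fin (2 ℕ.+ k)) → Carrier) →
             Fin (suc k) → Carrier
    restOf a W j = ε * ε ^ toℕ j * a (suc j) * sum (innerOf a W j)
    rest = restOf a W

    firstRow : 1# * a zero * sum first ≈ sum column
    firstRow = *-distribˡ-sum _ first

    otherRow : ∀ j → ε * ε ^ toℕ j * a (suc j) * (1# * a zero * V j + sum (inner j)) ≈ ε * column j + rest j
    otherRow j = solve 7 (λ e s x o y v t →
        e :* s :* x :* (o :* y :* v :+ t) := e :* (o :* y :* (s :* x :* v)) :+ e :* s :* x :* t)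
      refl ε (ε ^ toℕ j) (a (suc j)) 1# (a zero) (V j) (sum (inner j))

    rest≈0 : ∀ k (a : Fin (2 ℕ.+ k) → Carrier) (W : (Fin k → Fin (2 ℕ.+ k)) → Carrier) →
             (∀ {f g} → f ≗ g → W f ≈ W g) → sum (restOf a W) ≈ 0#
    rest≈0 zero    a W W-cong = sum-zero {t = restOf a W} λ j → zeroʳ _
    rest≈0 (suc k) a W W-cong = begin
      sum (restOf a W)     ≈⟨ sum-cong-≋ step ⟩
      sum smaller          ≈⟨ alternatingSum≈0 k (tail a) W′ W′-cong ⟩
      0#                   ∎
      where
      -- In these terms neither deleted column is column 0, so it heads the surviving columns
      -- throughout. `W′` fixes it, and the recursion runs over the other columns; the two factors
      -- `ε` from the shifts of `j` and `l` cancel.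
      W′ : (Fin k → Fin (2 ℕ.+ k)) → Carrier
      W′ f = W (zero ∷ suc ∘ f)

      W′-cong : ∀ {f g} → f ≗ g → W′ f ≈ W′ g
      W′-cong f≗g = W-cong λ { zero → ≡.refl ; (suc t) → ≡.cong suc (f≗g t) }

      term : Fin (2 ℕ.+ k) → Fin (suc k) → Carrier
      term j l = ε ^ toℕ l * a (suc (punchIn j l)) * W′ (punchIn j ∘ punchIn l)

      smaller : Fin (2 ℕ.+ k) → Carrier
      smaller j = ε ^ toℕ j * a (suc j) * sum (term j)

      innerStep : ∀ j l → innerOf a W j l ≈ ε * term j l
      innerStep j l = trans
        -- The two column maps agree only pointwise, on 0 and on successors separately.
        (*-congˡ (W-cong λ { zero → ≡.refl ; (suc t) → ≡.refl }))
        (solve 4 (λ e s x w → e :* s :* x :* w := e :* (s :* x :* w)) refl ε (ε ^ toℕ l) _ _)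

      step : ∀ j → restOf a W j ≈ smaller j
      step j = begin
        ε * ε ^ toℕ j * a (suc j) * sum (innerOf a W j)
          ≈⟨ *-congˡ (trans (sum-cong-≋ (innerStep j)) (sym (*-distribˡ-sum ε (term j)))) ⟩
        ε * ε ^ toℕ j * a (suc j) * (ε * sum (term j))
          ≈⟨ solve 4 (λ e s x t → e :* s :* x :* (e :* t) := e :* e :* (s :* x :* t)) refl ε (ε ^ toℕ j) _ _ ⟩
        ε * ε * smaller j
          ≈⟨ *-congʳ ε*ε≈1 ⟩
        1# * smaller j
          ≈⟨ *-identityˡ _ ⟩
        smaller j ∎

  -- Expansion along both equal rows gives the double sum of `alternatingSum≈0`.
  det-repeatFirst : ∀ {k} (a : Fin (2 ℕ.+ k) → Carrier) (N : Fin k → Fin (2 ℕ.+ k) → Carrier) →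
                    det (a ∷ a ∷ N) ≈ 0#
  det-repeatFirst {k} a N = alternatingSum≈0 k a (λ f → det λ i t → N i (f t))
    (λ f≗g → det-cong λ i t → reflexive (≡.cong (N i) (f≗g t)))

  -- Carries a relation between minors up to the determinant, so that row operations can be done
  -- below the first row.
  det-tailCong : ∀ {k} (x : Carrier) (a : Fin (suc k) → Carrier) (M N : Fin k → Fin (suc k) → Carrier) →
    (∀ j → minor M j ≈ x * minor N j) →
    det (a ∷ M) ≈ x * det (a ∷ N)
  det-tailCong x a M N minors = begin
    det (a ∷ M)
      ≈⟨ sum-cong-≋ (λ j → trans (*-congˡ (minors j))
           (solve 3 (λ s y d → s :* (y :* d) := y :* (s :* d)) refl (ε ^ toℕ j * a j) x (minor N j))) ⟩
    sum (λ j → x * laplaceTerm a N j)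
      ≈⟨ *-distribˡ-sum x (laplaceTerm a N) ⟨
    x * det (a ∷ N) ∎

  det-+₀ : ∀ {k} (a b : Fin (suc k) → Carrier) (N : Fin k → Fin (suc k) → Carrier) →
           det ((λ j → a j + b j) ∷ N) ≈ det (a ∷ N) + det (b ∷ N)
  det-+₀ a b N = trans
    (sum-cong-≋ λ j → solve 4 (λ s x y d → s :* (x :+ y) :* d := s :* x :* d :+ s :* y :* d)
      refl (ε ^ toℕ j) (a j) (b j) (minor N j))
    (∑-distrib-+ (laplaceTerm a N) (laplaceTerm b N))

  det-+₁ : ∀ {k} (a b c : Fin (2 ℕ.+ k) → Carrier) (N : Fin k → Fin (2 ℕ.+ k) → Carrier) →
           det (a ∷ (λ j → b j + c j) ∷ N) ≈ det (a ∷ b ∷ N) + det (a ∷ c ∷ N)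
  det-+₁ a b c N = trans
    (sum-cong-≋ λ j → trans
      (*-congˡ (det-+₀ (b ∘ punchIn j) (c ∘ punchIn j) (λ i l → N i (punchIn j l))))
      (distribˡ (ε ^ toℕ j * a j) _ _))
    (∑-distrib-+ (laplaceTerm a (b ∷ N)) (laplaceTerm a (c ∷ N)))

  -- Polarisation: put `a + b` in both of the first two rows and expand. Antisymmetry is derived
  -- from alternation and not conversely, as 2 may fail to be cancellable.
  det-swapFirst : ∀ {k} (a b : Fin (2 ℕ.+ k) → Carrier) (N : Fin k → Fin (2 ℕ.+ k) → Carrier) →
                  det (a ∷ b ∷ N) ≈ ε * det (b ∷ a ∷ N)
  det-swapFirst a b N = x+y≈0⇒x≈εy (begin
    det (a ∷ b ∷ N) + det (b ∷ a ∷ N)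
      ≈⟨ +-cong (trans (+-congʳ (det-repeatFirst a N)) (+-identityˡ _))
                (trans (+-congˡ (det-repeatFirst b N)) (+-identityʳ _)) ⟨
    (det (a ∷ a ∷ N) + det (a ∷ b ∷ N)) + (det (b ∷ a ∷ N) + det (b ∷ b ∷ N))
      ≈⟨ +-cong (det-+₁ a a b N) (det-+₁ b a b N) ⟨
    det (a ∷ (λ j → a j + b j) ∷ N) + det (b ∷ (λ j → a j + b j) ∷ N)
      ≈⟨ det-+₀ a b ((λ j → a j + b j) ∷ N) ⟨
    det ((λ j → a j + b j) ∷ (λ j → a j + b j) ∷ N)
      ≈⟨ det-repeatFirst (λ j → a j + b j) N ⟩
    0# ∎)

  -- Mutual induction: row `i` first rises to second place, by `det-moveFirst` applied to every
  -- minor, and then swaps with the top row. It passes `i` rows in all, the others keeping their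
  -- order.
  det-moveFirst : ∀ {k} (M : Fin (suc k) → Fin (suc k) → Carrier) (i : Fin (suc k)) →
                  det (M i ∷ removeAt M i) ≈ ε ^ toℕ i * det M
  det-moveSecond : ∀ {k} (a : Fin (2 ℕ.+ k) → Carrier) (N : Fin (suc k) → Fin (2 ℕ.+ k) → Carrier)
                   (i : Fin (suc k)) → det (a ∷ N i ∷ removeAt N i) ≈ ε ^ toℕ i * det (a ∷ N)

  det-moveFirst         M zero    = sym (*-identityˡ (det M))
  det-moveFirst {suc k} M (suc i) = begin
    det (M (suc i) ∷ M zero ∷ removeAt (tail M) i)       ≈⟨ det-swapFirst (M (suc i)) (M zero) (removeAt (tail M) i) ⟩
    ε * det (M zero ∷ M (suc i) ∷ removeAt (tail M) i)   ≈⟨ *-congˡ (det-moveSecond (M zero) (tail M) i) ⟩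
    ε * (ε ^ toℕ i * det M)                              ≈⟨ *-assoc ε _ _ ⟨
    ε * ε ^ toℕ i * det M                                ∎

  det-moveSecond a N i = det-tailCong (ε ^ toℕ i) a (N i ∷ removeAt N i) N
    λ j → det-moveFirst (λ r l → N r (punchIn j l)) i

  -- Moving row `i` of `N` up to second place, at the cost of a sign, makes the equal rows adjacent.
  -- Orthogonality of the polynomials below rests on this.
  det-repeat : ∀ {k} (N : Fin k → Fin (suc k) → Carrier) (i : Fin k) → det (N i ∷ N) ≈ 0#
  det-repeat {suc k} N i = ε^n*x≈0⇒x≈0 (toℕ i)
    (trans (sym (det-moveSecond (N i) N i)) (det-repeatFirst (N i) (removeAt N i)))

  det-linear₀ : ∀ {k n} (d : Fin n → Carrier) (A : Fin n → Fin (suc k) → Carrier)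
    (N : Fin k → Fin (suc k) → Carrier) →
    det ((λ j → sum λ i → d i * A i j) ∷ N) ≈ sum (λ i → d i * det (A i ∷ N))
  det-linear₀ {k} {n} d A N = begin
    sum (λ j → ε ^ toℕ j * sum (λ i → d i * A i j) * minor N j)
      ≈⟨ sum-cong-≋ (λ j → trans (*-congʳ (*-distribˡ-sum (ε ^ toℕ j) (λ i → d i * A i j)))
           (trans (*-distribʳ-sum (minor N j) (λ i → ε ^ toℕ j * (d i * A i j)))
             (sum-cong-≋ λ i → solve 4 (λ s x y m → s :* (x :* y) :* m := x :* (s :* y :* m))
               refl (ε ^ toℕ j) (d i) (A i j) (minor N j)))) ⟩
    sum (λ j → sum λ i → d i * (ε ^ toℕ j * A i j * minor N j))
      ≈⟨ ∑-comm (λ j i → d i * (ε ^ toℕ j * A i j * minor N j)) ⟩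
    sum (λ i → sum λ j → d i * (ε ^ toℕ j * A i j * minor N j))
      ≈⟨ sum-cong-≋ (λ i → *-distribˡ-sum (d i) (λ j → ε ^ toℕ j * A i j * minor N j)) ⟨
    sum (λ i → d i * det (A i ∷ N)) ∎

  -- Cramer's rule for a homogeneous system: substitute the vanishing combination
  -- of the rows for row i, after moving that row to the front.
  leftKernel : ∀ {k} (M : Fin k → Fin k → Carrier) (d : Fin k → Carrier) →
    (∀ j → sum (λ i → d i * M i j) ≈ 0#) → ∀ i → d i * det M ≈ 0#
  leftKernel {suc k} M d dM≈0 i = ε^n*x≈0⇒x≈0 (toℕ i) (begin
    ε ^ toℕ i * (d i * det M)
      ≈⟨ solve 3 (λ s x y → s :* (x :* y) := x :* (s :* y)) refl (ε ^ toℕ i) (d i) (det M) ⟩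
    d i * (ε ^ toℕ i * det M)
      ≈⟨ *-congˡ (det-moveFirst M i) ⟨
    d i * det (M i ∷ N)
      ≈⟨ +-identityʳ _ ⟨
    d i * det (M i ∷ N) + 0#
      -- The terms put in all have a repeated row; with them the sum runs over every row of `M`.
      ≈⟨ +-congˡ (sum-zero λ l → trans (*-congˡ (det-repeat N l)) (zeroʳ _)) ⟨
    d i * det (M i ∷ N) + sum (λ l → d (punchIn i l) * det (N l ∷ N))
      ≈⟨ sum-remove {i = i} (λ l → d l * det (M l ∷ N)) ⟨
    sum (λ l → d l * det (M l ∷ N))
      ≈⟨ det-linear₀ d M N ⟨
    det ((λ j → sum λ l → d l * M l j) ∷ N)
      ≈⟨ sum-zero {t = laplaceTerm (λ j → sum λ l → d l * M l j) N} (λ j → trans (*-congʳ (trans (*-congˡ (dM≈0 j)) (zeroʳ _))) (zeroˡ _)) ⟩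
    0# ∎)
    where
    N = removeAt M i

punchIn-fromℕ : ∀ {k} (i : Fin k) → toℕ (punchIn (fromℕ k) i) ≡ toℕ i
punchIn-fromℕ zero    = ≡.refl
punchIn-fromℕ (suc i) = ≡.cong suc (punchIn-fromℕ i)

-- Hankel determinants and the orthogonal polynomials formed from their minors.

module HankelPolynomials {c ℓ} (R : CommutativeRing c ℓ) (f : ℕ → CommutativeRing.Carrier R) where
  open CommutativeRing R hiding (zero)
  open Determinant R
  open DeterminantProperties R
  open SemiringExp semiring using (_^_; ^-congʳ)
  open SemiringSum semiring
  open SetoidReasoning setoid
  open Solver commutativeSemiring using (solve; _:+_; _:*_; _:=_)

  row : ∀ {k} → ℕ → Fin k → Carrier
  row t j = f (t ℕ.+ toℕ j)

  hankel : ∀ {k l} → ℕ → Fin k → Fin l → Carrier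
  hankel s i = row (s ℕ.+ toℕ i)

  hankelDet : ℕ → ℕ → Carrier
  hankelDet k s = det {k} (hankel s)

  -- The polynomial of degree k orthogonal to x^s, …, x^(s+k-1) for the functional
  -- x^t ↦ f t, not normalised.
  coefficient : ∀ k → ℕ → Fin (suc k) → Carrier
  coefficient k s j = ε ^ toℕ j * minor {k} (hankel s) j

  -- The value of the functional at `x^t` times the polynomial with coefficients `d`.
  pairing : ∀ {k} → (Fin k → Carrier) → ℕ → Carrier
  pairing d t = sum λ j → d j * row t j

  sum-moments-cong : ∀ {k} (d : Fin k → Carrier) {x y : Fin k → ℕ} → x ≗ y →
                     sum (λ j → d j * f (x j)) ≈ sum (λ j → d j * f (y j))
  sum-moments-cong d x≗y = sum-cong-≋ λ j → *-congˡ {x = d j} (reflexive (≡.cong f (x≗y j)))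

  -- A Laplace expansion read backwards. The next three values follow by the place of `t`: among the
  -- rows `s`, ..., `s + k - 1` it repeats one, and just before or just after them it completes a
  -- larger Hankel matrix.
  pairing-coefficient : ∀ k s t → pairing (coefficient k s) t ≈ det (row t ∷ hankel {k} s)
  pairing-coefficient k s t = sum-cong-≋ λ j →
    solve 3 (λ x y z → x :* y :* z := x :* z :* y) refl (ε ^ toℕ j) (minor {k} (hankel s) j) (row t j)

  pairing-orthogonal : ∀ k s (i : Fin k) → pairing (coefficient k s) (s ℕ.+ toℕ i) ≈ 0#
  pairing-orthogonal k s i = trans (pairing-coefficient k s _) (det-repeat (hankel s) i)

  pairing-below : ∀ k s → pairing (coefficient k (suc s)) s ≈ hankelDet (suc k) s
  pairing-below k s = trans (pairing-coefficient k (suc s) s) (det-cong sameRows)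
    where
    sameRows : ∀ i j → (row s ∷ hankel {k} (suc s)) i j ≈ hankel {suc k} {suc k} s i j
    sameRows zero    j = reflexive (≡.cong (λ t → row t j) (≡.sym (ℕ.+-identityʳ s)))
    sameRows (suc i) j = reflexive (≡.cong (λ t → row t j) (≡.sym (ℕ.+-suc s (toℕ i))))

  -- The new row belongs at the bottom, `k` places below where the border puts it; hence the sign.
  pairing-above : ∀ k s → pairing (coefficient k s) (s ℕ.+ k) ≈ ε ^ k * hankelDet (suc k) s
  pairing-above k s = begin
    pairing (coefficient k s) (s ℕ.+ k)                                     ≈⟨ pairing-coefficient k s _ ⟩
    det (row (s ℕ.+ k) ∷ hankel {k} s)                                      ≈⟨ det-cong sameRows ⟨
    det (hankel {suc k} s (fromℕ k) ∷ removeAt (hankel {suc k} s) (fromℕ k))  ≈⟨ det-moveFirst (hankel s) (fromℕ k) ⟩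
    ε ^ toℕ (fromℕ k) * hankelDet (suc k) s                                 ≈⟨ *-congʳ (^-congʳ ε (toℕ-fromℕ k)) ⟩
    ε ^ k * hankelDet (suc k) s                                             ∎
    where
    sameRows : ∀ i j → (hankel {suc k} s (fromℕ k) ∷ removeAt (hankel {suc k} s) (fromℕ k)) i j
                     ≈ (row {suc k} (s ℕ.+ k) ∷ hankel s) i j
    sameRows zero    j = reflexive (≡.cong (λ t → row (s ℕ.+ t) j) (toℕ-fromℕ k))
    sameRows (suc i) j = reflexive (≡.cong (λ t → row (s ℕ.+ t) j) (punchIn-fromℕ i))

  -- Serves twice: for the leading coefficient of the polynomial, and for the value of `c` at
  -- `m = 0`.
  minor-last : ∀ k s → minor {k} (hankel s) (fromℕ k) ≈ hankelDet k s
  minor-last k s = det-cong {k} λ i l →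
    reflexive (≡.cong (λ t → f (s ℕ.+ toℕ i ℕ.+ t)) (punchIn-fromℕ l))

  coefficient-last : ∀ k s → coefficient k s (fromℕ k) ≈ ε ^ k * hankelDet k s
  coefficient-last k s = *-cong (^-congʳ ε (toℕ-fromℕ k)) (minor-last k s)

  pairing-init : ∀ {k} (d : Fin (suc k) → Carrier) t →
                 pairing d t ≈ pairing (init d) t + d (fromℕ k) * f (t ℕ.+ k)
  pairing-init {k} d t = trans (sum-init-last λ j → d j * row t j) (+-cong
    (sum-moments-cong (init d) λ j → ≡.cong (t ℕ.+_) (toℕ-inject₁ j))
    (*-congˡ (reflexive (≡.cong (λ x → f (t ℕ.+ x)) (toℕ-fromℕ k)))))

  -- Prepending a zero coefficient is multiplication by `x`.
  pairing-shift : ∀ {k} (d : Fin k → Carrier) t → pairing (0# ∷ d) t ≈ pairing d (suc t)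
  pairing-shift d t = trans (+-cong (zeroˡ _) (sum-moments-cong d λ j → ℕ.+-suc t (toℕ j)))
    (+-identityˡ _)

  sum-linear₄ : ∀ {k} (d₁ d₂ d₃ d₄ : Fin k → Carrier) x₁ x₂ x₃ x₄ (g : Fin k → Carrier) →
    sum (λ j → (d₁ j * x₁ + d₂ j * x₂ + d₃ j * x₃ + d₄ j * x₄) * g j) ≈
    sum (λ j → d₁ j * g j) * x₁ + sum (λ j → d₂ j * g j) * x₂
    + sum (λ j → d₃ j * g j) * x₃ + sum (λ j → d₄ j * g j) * x₄
  sum-linear₄ {zero} d₁ d₂ d₃ d₄ x₁ x₂ x₃ x₄ g = sym (begin
    0# * x₁ + 0# * x₂ + 0# * x₃ + 0# * x₄
      ≈⟨ +-cong (+-cong (+-cong (zeroˡ x₁) (zeroˡ x₂)) (zeroˡ x₃)) (zeroˡ x₄) ⟩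
    0# + 0# + 0# + 0#
      ≈⟨ trans (+-identityʳ _) (trans (+-identityʳ _) (+-identityʳ _)) ⟩
    0# ∎)
  sum-linear₄ {suc k} d₁ d₂ d₃ d₄ x₁ x₂ x₃ x₄ g = trans
    (+-congˡ (sum-linear₄ (tail d₁) (tail d₂) (tail d₃) (tail d₄) x₁ x₂ x₃ x₄ (tail g)))
    (solve 13 (λ a b c d x y z w g p q r s →
       (a :* x :+ b :* y :+ c :* z :+ d :* w) :* g :+ (p :* x :+ q :* y :+ r :* z :+ s :* w) :=
       (a :* g :+ p) :* x :+ (b :* g :+ q) :* y :+ (c :* g :+ r) :* z :+ (d :* g :+ s) :* w)
     refl (d₁ zero) (d₂ zero) (d₃ zero) (d₄ zero) x₁ x₂ x₃ x₄ (g zero)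
       (rest d₁) (rest d₂) (rest d₃) (rest d₄))
    where
    rest : (Fin (suc k) → Carrier) → Carrier
    rest d = sum λ j → d (suc j) * g (suc j)

  -- Here α = 2 + a and f t = r_{1,n+1-α+t}, so that u, p, q, w are r_{α,n}, r_{α-1,n},
  -- r_{α-1,n+1}, r_{α,n+1}.
  module Recurrence (a : ℕ) where
    u p q w : Carrier
    u = hankelDet (2 ℕ.+ a) 0
    p = hankelDet (1 ℕ.+ a) 1
    q = hankelDet (1 ℕ.+ a) 2
    w = hankelDet (2 ℕ.+ a) 1

    P₂ : Fin (3 ℕ.+ a) → Carrier
    P₂ = coefficient (2 ℕ.+ a) 0

    P₁ : Fin (2 ℕ.+ a) → Carrier
    P₁ = coefficient (1 ℕ.+ a) 1

    P₀ : Fin (1 ℕ.+ a) → Carrier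
    P₀ = coefficient a 2

    -- P₂ p q + x P₁ u q − P₁ w p + x P₀ w u, without its leading term, which vanishes.
    defect : Fin (2 ℕ.+ a) → Carrier
    defect j = init P₂ j * (p * q) + (0# ∷ init P₁) j * (u * q) + P₁ j * (ε * (w * p)) + (0# ∷ P₀) j * (w * u)

    -- Full polynomials may replace the truncated ones: the leading terms of `P₂` and `x P₁` add
    -- opposite multiples, `ε * e * u * p * q` and `e * p * u * q`, of the same moment `x`.
    pairing-defect : ∀ t → pairing defect t ≈
      pairing P₂ t * (p * q) + pairing P₁ (suc t) * (u * q) + pairing P₁ t * (ε * (w * p)) + pairing P₀ (suc t) * (w * u)
    pairing-defect t = begin
      pairing defect t
        ≈⟨ sum-linear₄ (init P₂) (0# ∷ init P₁) P₁ (0# ∷ P₀) _ _ _ _ (row t) ⟩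
      S₂ * (p * q) + pairing (0# ∷ init P₁) t * (u * q) + T + pairing (0# ∷ P₀) t * (w * u)
        ≈⟨ +-cong (+-congʳ (+-congˡ (*-congʳ (pairing-shift (init P₁) t)))) (*-congʳ (pairing-shift P₀ t)) ⟩
      S₂ * (p * q) + S₁ * (u * q) + T + T′
        ≈⟨ +-congʳ (+-congʳ (trans (+-congˡ (x+εx≈0 (e * u * x * (p * q)))) (+-identityʳ _))) ⟨
      S₂ * (p * q) + S₁ * (u * q) + (e * u * x * (p * q) + ε * (e * u * x * (p * q))) + T + T′
        ≈⟨ solve 10 (λ S₂ S₁ p q u e x ε T T′ →
             S₂ :* (p :* q) :+ S₁ :* (u :* q) :+ (e :* u :* x :* (p :* q) :+ ε :* (e :* u :* x :* (p :* q))) :+ T :+ T′ :=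
             (S₂ :+ ε :* e :* u :* x) :* (p :* q) :+ (S₁ :+ e :* p :* x) :* (u :* q) :+ T :+ T′)
           refl S₂ S₁ p q u e x ε T T′ ⟩
      (S₂ + ε * e * u * x) * (p * q) + (S₁ + e * p * x) * (u * q) + T + T′
        ≈⟨ +-congʳ (+-congʳ (+-cong (*-congʳ full₂) (*-congʳ full₁))) ⟨
      pairing P₂ t * (p * q) + pairing P₁ (suc t) * (u * q) + T + T′ ∎
      where
      S₂ = pairing (init P₂) t
      S₁ = pairing (init P₁) (suc t)
      T  = pairing P₁ t * (ε * (w * p))
      T′ = pairing P₀ (suc t) * (w * u)
      e  = ε ^ (1 ℕ.+ a)
      x  = f (t ℕ.+ (2 ℕ.+ a))

      full₂ : pairing P₂ t ≈ S₂ + ε * e * u * x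
      full₂ = trans (pairing-init P₂ t) (+-congˡ (*-congʳ (coefficient-last (2 ℕ.+ a) 0)))

      full₁ : pairing P₁ (suc t) ≈ S₁ + e * p * x
      full₁ = trans (pairing-init P₁ (suc t)) (+-congˡ (*-cong
        (coefficient-last (1 ℕ.+ a) 1) (reflexive (≡.cong f (≡.sym (ℕ.+-suc t (1 ℕ.+ a)))))))

    -- `P₂` is orthogonal to all these powers. At `t = 0` also `x P₁` drops out, and `P₁`, `x P₀`
    -- pair to `u`, `p`; at `t = 1 + a` it is `P₁` that drops out, and `x P₁`, `x P₀` pair to `w`,
    -- `q` up to sign. The factors in `defect` make each pair cancel. In between every term
    -- vanishes.
    pairing-defect≈0 : ∀ i → pairing defect (toℕ {2 ℕ.+ a} i) ≈ 0#
    pairing-defect≈0 i = trans (pairing-defect (toℕ i))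
      (trans (+-congʳ (+-congʳ (+-congʳ (trans (*-congʳ (pairing-orthogonal (2 ℕ.+ a) 0 i)) (zeroˡ _))))) (remaining i))
      where
      remaining : ∀ i → 0# + pairing P₁ (suc (toℕ {2 ℕ.+ a} i)) * (u * q) + pairing P₁ (toℕ i) * (ε * (w * p))
                        + pairing P₀ (suc (toℕ i)) * (w * u) ≈ 0#
      remaining zero = begin
        0# + pairing P₁ 1 * (u * q) + pairing P₁ 0 * (ε * (w * p)) + pairing P₀ 1 * (w * u)
          ≈⟨ +-cong (+-cong (trans (+-identityˡ _) (trans (*-congʳ (pairing-orthogonal (1 ℕ.+ a) 1 zero)) (zeroˡ _)))
               (*-congʳ (pairing-below (1 ℕ.+ a) 0))) (*-congʳ (pairing-below a 1)) ⟩
        0# + u * (ε * (w * p)) + p * (w * u)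
          ≈⟨ +-congʳ (+-identityˡ _) ⟩
        u * (ε * (w * p)) + p * (w * u)
          ≈⟨ solve 4 (λ u ε w p → u :* (ε :* (w :* p)) :+ p :* (w :* u) := p :* (w :* u) :+ ε :* (p :* (w :* u))) refl u ε w p ⟩
        p * (w * u) + ε * (p * (w * u))
          ≈⟨ x+εx≈0 _ ⟩
        0# ∎
      remaining (suc i) = begin
        0# + pairing P₁ (2 ℕ.+ toℕ i) * (u * q) + pairing P₁ (1 ℕ.+ toℕ i) * (ε * (w * p)) + pairing P₀ (2 ℕ.+ toℕ i) * (w * u)
          ≈⟨ +-congʳ (+-cong (+-identityˡ _) (trans (*-congʳ (pairing-orthogonal (1 ℕ.+ a) 1 i)) (zeroˡ _))) ⟩
        pairing P₁ (2 ℕ.+ toℕ i) * (u * q) + 0# + pairing P₀ (2 ℕ.+ toℕ i) * (w * u)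
          ≈⟨ +-congʳ (+-identityʳ _) ⟩
        pairing P₁ (2 ℕ.+ toℕ i) * (u * q) + pairing P₀ (2 ℕ.+ toℕ i) * (w * u)
          ≈⟨ outer i ⟩
        0# ∎
        where
        outer : ∀ i → pairing P₁ (2 ℕ.+ toℕ {1 ℕ.+ a} i) * (u * q) + pairing P₀ (2 ℕ.+ toℕ i) * (w * u) ≈ 0#
        outer i with view i
        -- The top power `x^(1 + a)`: both pairings lie one step above the orthogonality range.
        ... | ‵fromℕ rewrite toℕ-fromℕ a = begin
          pairing P₁ (2 ℕ.+ a) * (u * q) + pairing P₀ (2 ℕ.+ a) * (w * u)
            ≈⟨ +-cong (*-congʳ (pairing-above (1 ℕ.+ a) 1)) (*-congʳ (pairing-above a 2)) ⟩
          ε * ε ^ a * w * (u * q) + ε ^ a * q * (w * u)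
            ≈⟨ solve 5 (λ ε e w u q → ε :* e :* w :* (u :* q) :+ e :* q :* (w :* u) :=
                 e :* q :* (w :* u) :+ ε :* (e :* q :* (w :* u))) refl ε (ε ^ a) w u q ⟩
          ε ^ a * q * (w * u) + ε * (ε ^ a * q * (w * u))
            ≈⟨ x+εx≈0 _ ⟩
          0# ∎
        ... | ‵inject₁ k rewrite toℕ-inject₁ k = trans
          (+-cong (trans (*-congʳ (pairing-orthogonal (1 ℕ.+ a) 1 (suc k))) (zeroˡ _))
                  (trans (*-congʳ (pairing-orthogonal a 2 k)) (zeroˡ _)))
          (+-identityˡ 0#)

    -- What precedes holds for any moments in a commutative ring; cancelling `u`, the determinant of
    -- the Hankel system, is what forces `defect` itself to vanish.
    module _ (u-cancel : ∀ {x} → x * u ≈ 0# → x ≈ 0#) where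
      defect≈0 : ∀ j → defect j ≈ 0#
      defect≈0 j = u-cancel (leftKernel (hankel 0) defect (λ l → trans
        -- Symmetry of the Hankel matrix: combining its rows with weights `defect` is pairing
        -- `defect` with powers of `x`.
        (sum-moments-cong defect λ i → ℕ.+-comm (toℕ i) (toℕ l))
        (pairing-defect≈0 l)) j)

      -- Constant coefficients, to which `x P₁` and `x P₀` contribute nothing. This becomes the case
      -- `m = α`.
      recurrence-zero : minor {2 ℕ.+ a} (hankel 0) zero * (p * q) ≈ w * (minor {1 ℕ.+ a} (hankel 1) zero * p)
      recurrence-zero = x+εy≈0⇒x≈y (begin
        E₂ * (p * q) + ε * (w * (E₁ * p))
          ≈⟨ +-cong (*-congʳ (*-identityˡ E₂)) (trans (*-congʳ (*-identityˡ E₁))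
               (solve 4 (λ x ε w p → x :* (ε :* (w :* p)) := ε :* (w :* (x :* p))) refl E₁ ε w p)) ⟨
        1# * E₂ * (p * q) + 1# * E₁ * (ε * (w * p))
          ≈⟨ trans (+-cong (+-congʳ (trans (+-congˡ (zeroˡ _)) (+-identityʳ _))) (zeroˡ _)) (+-identityʳ _) ⟨
        defect zero
          ≈⟨ defect≈0 zero ⟩
        0# ∎)
        where
        E₂ = minor {2 ℕ.+ a} (hankel 0) zero
        E₁ = minor {1 ℕ.+ a} (hankel 1) zero

      -- Coefficients of `x^(j+1)`, divided by the sign `ε^(j+1)`. The multiples of `x` carry only
      -- `ε^j`, and the `P₁` term has its own `ε`, so all three terms cross to the right with a plus
      -- sign.
      recurrence-suc : ∀ (j : Fin (1 ℕ.+ a)) →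
        minor {2 ℕ.+ a} (hankel 0) (suc (inject₁ j)) * (p * q) ≈
        minor {1 ℕ.+ a} (hankel 1) (inject₁ j) * (u * q) + w * (minor {1 ℕ.+ a} (hankel 1) (suc j) * p)
        + w * (minor {a} (hankel 2) j * u)
      recurrence-suc j = x+εy≈0⇒x≈y (ε^n*x≈0⇒x≈0 (suc (toℕ j)) (begin
        ε * e * (E₂ * (p * q) + ε * (E₁ * (u * q) + w * (E₁′ * p) + w * (E₀ * u)))
          ≈⟨ solve 10 (λ ε e E₂ E₁ E₁′ E₀ p q u w →
               ε :* e :* (E₂ :* (p :* q) :+ ε :* (E₁ :* (u :* q) :+ w :* (E₁′ :* p) :+ w :* (E₀ :* u))) :=
               ε :* e :* E₂ :* (p :* q) :+ ε :* (ε :* (e :* E₁ :* (u :* q)))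
               :+ ε :* e :* E₁′ :* (ε :* (w :* p)) :+ ε :* (ε :* (e :* E₀ :* (w :* u))))
             refl ε e E₂ E₁ E₁′ E₀ p q u w ⟩
        ε * e * E₂ * (p * q) + ε * (ε * (e * E₁ * (u * q)))
        + ε * e * E₁′ * (ε * (w * p)) + ε * (ε * (e * E₀ * (w * u)))
          ≈⟨ +-cong (+-congʳ (+-cong (*-congʳ (*-congʳ (*-congˡ e≈))) (trans (ε*εx≈x _) (*-congʳ (*-congʳ e≈))))) (ε*εx≈x _) ⟩
        defect (suc j)
          ≈⟨ defect≈0 (suc j) ⟩
        0# ∎))
        where
        e   = ε ^ toℕ j
        E₂  = minor {2 ℕ.+ a} (hankel 0) (suc (inject₁ j))
        E₁  = minor {1 ℕ.+ a} (hankel 1) (inject₁ j)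
        E₁′ = minor {1 ℕ.+ a} (hankel 1) (suc j)
        E₀  = minor {a} (hankel 2) j

        e≈ : e ≈ ε ^ toℕ (inject₁ j)
        e≈ = ^-congʳ ε (≡.sym (toℕ-inject₁ j))

-- Matching integer indices with row and column numbers.

-- `s p` skips the number `p + 1` counted from 1, which is column `p` counted from 0.
s-punchIn : ∀ {k} (j : Fin (suc k)) (l : Fin k) → s (toℕ j) (suc (toℕ l)) ≡ suc (toℕ (punchIn j l))
s-punchIn zero    l       = ≡.refl
s-punchIn (suc j) zero    = ≡.refl
s-punchIn (suc j) (suc l) = ≡.trans
  (≡.sym (if-float suc (toℕ l ℕ.<ᵇ toℕ j))) (≡.cong suc (s-punchIn j l))

-- The hypothesis says that the top left entry, of index `n + 1 - k`, lies `s` places after the base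
-- `b`; `i` and `j` count from 0.
index-shift : ∀ {n b} s k i j → n ℤ.+ 1ℤ ≡ b ℤ.+ + s ℤ.+ + k →
  n ℤ.+ + suc i ℤ.+ + suc j ℤ.- 1ℤ ℤ.- + k ≡ b ℤ.+ + (s ℕ.+ i ℕ.+ j)
index-shift {n} {b} s k i j eq = begin
  n ℤ.+ + suc i ℤ.+ + suc j ℤ.- 1ℤ ℤ.- + k
    ≡⟨ solve 4 (λ n i j k → n :+ (con 1ℤ :+ i) :+ (con 1ℤ :+ j) :- con 1ℤ :- k := (n :+ con 1ℤ) :+ i :+ j :- k) ≡.refl n (+ i) (+ j) (+ k) ⟩
  (n ℤ.+ 1ℤ) ℤ.+ + i ℤ.+ + j ℤ.- + k
    ≡⟨ ≡.cong (λ x → x ℤ.+ + i ℤ.+ + j ℤ.- + k) eq ⟩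
  b ℤ.+ + s ℤ.+ + k ℤ.+ + i ℤ.+ + j ℤ.- + k
    ≡⟨ solve 5 (λ b s k i j → b :+ s :+ k :+ i :+ j :- k := b :+ (s :+ i :+ j)) ≡.refl b (+ s) (+ k) (+ i) (+ j) ⟩
  b ℤ.+ + (s ℕ.+ i ℕ.+ j) ∎
  where
  open ≡.≡-Reasoning
  open ℤ.+-*-Solver

-- The hypothesis of `index-shift` for the base `n + 1 - α`, `α = 2 + a`: a matrix of size `k` taken
-- at `n + i` starts `o` places after it.
base-shift : ∀ n a o k i → o ℕ.+ k ≡ i ℕ.+ (2 ℕ.+ a) →
             n ℤ.+ + i ℤ.+ 1ℤ ≡ n ℤ.- + suc a ℤ.+ + o ℤ.+ + k
base-shift n a o k i eq = begin
  n ℤ.+ + i ℤ.+ 1ℤ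
    ≡⟨ solve 3 (λ n i a → n :+ i :+ con 1ℤ := n :- (con 1ℤ :+ a) :+ (i :+ (con (+ 2) :+ a))) ≡.refl n (+ i) (+ a) ⟩
  n ℤ.- + suc a ℤ.+ + (i ℕ.+ (2 ℕ.+ a))
    ≡⟨ ≡.cong (λ x → n ℤ.- + suc a ℤ.+ + x) eq ⟨
  n ℤ.- + suc a ℤ.+ + (o ℕ.+ k)
    ≡⟨ ℤ.+-assoc (n ℤ.- + suc a) (+ o) (+ k) ⟨
  n ℤ.- + suc a ℤ.+ + o ℤ.+ + k ∎
  where
  open ≡.≡-Reasoning
  open ℤ.+-*-Solver

-- The witness `k ∸ m` is the column, counted from 0, that `c k (+ m)` omits.
complementIndex : ∀ {m k} → m ≤ k → ∃[ j ] toℕ {suc k} j ℕ.+ m ≡ k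
complementIndex {m} {k} m≤k = fromℕ< k∸m<1+k ,
  ≡.trans (≡.cong (ℕ._+ m) (toℕ-fromℕ< k∸m<1+k)) (ℕ.m∸n+n≡m m≤k)
  where
  k∸m<1+k = ℕ.s≤s (ℕ.m∸n≤m k m)

-- Cancellation in a Heyting field.

module FieldProperties {k ℓ₁ ℓ₂} (K : HeytingField k ℓ₁ ℓ₂) where
  open HeytingField K using (_#_; #⇒invertible; heytingCommutativeRing)
  open HeytingCommutativeRing heytingCommutativeRing using (commutativeRing)
  open CommutativeRing commutativeRing hiding (zero)
  open Division K
  open HCRProperties heytingCommutativeRing using (x-0≈x)
  open SetoidReasoning setoid

  inverseʳ : ∀ {x} (x#0 : x # 0#) → x * inverse x x#0 ≈ 1#
  inverseʳ {x} x#0 = trans (*-congʳ (sym (x-0≈x x))) (proj₂ (proj₂ (#⇒invertible x#0)))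

  /-cancel : ∀ x {y} (y#0 : y # 0#) → (x / y [ y#0 ]) * y ≈ x
  /-cancel x {y} y#0 = begin
    x * inverse y y#0 * y     ≈⟨ *-assoc x _ y ⟩
    x * (inverse y y#0 * y)   ≈⟨ *-congˡ (trans (*-comm _ y) (inverseʳ y#0)) ⟩
    x * 1#                    ≈⟨ *-identityʳ x ⟩
    x                         ∎

  *-cancelʳ-# : ∀ {x y z} → z # 0# → x * z ≈ y * z → x ≈ y
  *-cancelʳ-# {x} {y} {z} z#0 eq = begin
    x                         ≈⟨ cancelled x ⟨
    x * z * inverse z z#0     ≈⟨ *-congʳ eq ⟩
    y * z * inverse z z#0     ≈⟨ cancelled y ⟩
    y                         ∎
    where
    cancelled : ∀ x → x * z * inverse z z#0 ≈ x
    cancelled x = trans (*-assoc x z _) (trans (*-congˡ (inverseʳ z#0)) (*-identityʳ x))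

-- `r` and `c` as Hankel determinants and minors of the moments counted from a base `b`.

module HankelShift {k ℓ₁ ℓ₂} (K : HeytingField k ℓ₁ ℓ₂) (r₁ : ℤ → HeytingField.Carrier K) (b : ℤ) where
  open HeytingField K using (heytingCommutativeRing)
  open HeytingCommutativeRing heytingCommutativeRing using (commutativeRing)
  open CommutativeRing commutativeRing hiding (zero)
  open DeterminantProperties commutativeRing
  open HankelPolynomials commutativeRing (λ t → r₁ (b ℤ.+ + t)) public
  open Hankel K r₁

  r≈hankelDet : ∀ k o {n} → n ℤ.+ 1ℤ ≡ b ℤ.+ + o ℤ.+ + k → r k n ≈ hankelDet k o
  r≈hankelDet zero      o     eq = refl
  r≈hankelDet k@(suc _) o {n} eq = det-cong {k} λ i j →
    reflexive (≡.cong r₁ (index-shift {n} {b} o k (toℕ i) (toℕ j) eq))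

  c≈minor : ∀ k o {n m} (j : Fin (suc k)) → toℕ j ℕ.+ m ≡ k →
            n ℤ.+ 1ℤ ≡ b ℤ.+ + o ℤ.+ + k → c k (+ m) n ≈ minor {k} (hankel o) j
  c≈minor k o {n} {m} j j+m≡k eq
    -- As `m ≤ k`, the test in `c` selects the determinant.
    rewrite Equivalence.to T-≡ (ℕ.≤⇒≤ᵇ (ℕ.m+n≤o⇒n≤o (toℕ j) (ℕ.≤-reflexive j+m≡k))) =
    det-cong {k} λ i l → reflexive (≡.cong r₁ (entry i l))
    where
    skipped : ∀ l → s (k ∸ m) (♯ l) ≡ ♯ (punchIn j l)
    skipped l = ≡.trans
      (≡.cong (λ x → s x (♯ l)) (≡.trans (≡.cong (_∸ m) (≡.sym j+m≡k)) (ℕ.m+n∸n≡m (toℕ j) m)))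
      (s-punchIn j l)

    entry : ∀ (i l : Fin k) → n ℤ.+ + ♯ i ℤ.+ + s (k ∸ m) (♯ l) ℤ.- + k ℤ.- 1ℤ
                              ≡ b ℤ.+ + (o ℕ.+ toℕ i ℕ.+ toℕ (punchIn j l))
    entry i l = ≡.trans (≡.cong (λ x → n ℤ.+ + ♯ i ℤ.+ + x ℤ.- + k ℤ.- 1ℤ) (skipped l))
      -- Entries of `c` subtract `k` before 1, those of `r` and `index-shift` after it.
      (≡.trans (CommutativeSemigroupProperties.xy∙z≈xz∙y ℤ.+-commutativeSemigroup (n ℤ.+ + ♯ i ℤ.+ + ♯ (punchIn j l)) (ℤ.- + k) (ℤ.- 1ℤ))
        (index-shift {n} {b} o k (toℕ i) (toℕ (punchIn j l)) eq))

-- The recurrence for `c`, cleared of denominators.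

module HankelMinors {k ℓ₁ ℓ₂} (K : HeytingField k ℓ₁ ℓ₂)
    (r₁ : ℤ → HeytingField.Carrier K) where
  open HeytingField K using (_#_; heytingCommutativeRing)
  open HeytingCommutativeRing heytingCommutativeRing using (commutativeRing)
  open CommutativeRing commutativeRing hiding (zero)
  open DeterminantProperties commutativeRing using (minor)
  open Hankel K r₁
  open FieldProperties K
  open SetoidReasoning setoid

  -- At `m = 0` the omitted column is the one just past the square matrix of `r`. The base
  -- `n + 1 - α` makes that matrix start at moment 0.
  c-zero≈r : ∀ α n → c α (+ 0) n ≈ r α n
  c-zero≈r α n = begin
    c α (+ 0) n                       ≈⟨ c≈minor α 0 {n} (fromℕ α) last shift ⟩
    minor {α} (hankel 0) (fromℕ α)    ≈⟨ minor-last α 0 ⟩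
    hankelDet α 0                     ≈⟨ r≈hankelDet α 0 {n} shift ⟨
    r α n                             ∎
    where
    b : ℤ
    b = n ℤ.+ 1ℤ ℤ.- + α
    open HankelShift K r₁ b

    last : toℕ (fromℕ α) ℕ.+ 0 ≡ α
    last = ≡.trans (ℕ.+-identityʳ _) (toℕ-fromℕ α)

    shift : n ℤ.+ 1ℤ ≡ b ℤ.+ + 0 ℤ.+ + α
    shift = solve 2 (λ n α → n :+ con 1ℤ := n :+ con 1ℤ :- α :+ con ℤ.0ℤ :+ α) ≡.refl n (+ α)
      where open ℤ.+-*-Solver

  c-above≈0 : ∀ α m n → α ℕ.< m → c α (+ m) n ≈ 0#
  c-above≈0 α m n α<m with m ℕ.≤ᵇ α in eq
  ... | false = refl
  ... | true  = contradiction (ℕ.≤ᵇ⇒≤ m α (Equivalence.from T-≡ eq)) (ℕ.<⇒≱ α<m)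

  -- Stated at `suc m`, so that the index `m - 1` of the recurrence becomes the natural number `m`.
  -- The omitted column of the largest minor decides which coefficient of `defect` is read.
  c-recurrence : (∀ α n → r α n # 0#) → ∀ a m n → m ≤ 1 ℕ.+ a →
    c (2 ℕ.+ a) (+ suc m) n * (r (1 ℕ.+ a) n * r (1 ℕ.+ a) (n ℤ.+ 1ℤ)) ≈
      c (1 ℕ.+ a) (+ suc m) n * (r (2 ℕ.+ a) n * r (1 ℕ.+ a) (n ℤ.+ 1ℤ))
      + r (2 ℕ.+ a) (n ℤ.+ 1ℤ) * (c (1 ℕ.+ a) (+ m) n * r (1 ℕ.+ a) n)
      + r (2 ℕ.+ a) (n ℤ.+ 1ℤ) * (c a (+ m) n * r (2 ℕ.+ a) n)
  c-recurrence r#0 a m n m≤1+a = split (complementIndex m≤1+a)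
    where
    open HankelShift K r₁ (n ℤ.- + suc a)
    open Recurrence a using (u; p; q; w; recurrence-zero; recurrence-suc)

    shift₀ : ∀ o k → o ℕ.+ k ≡ 2 ℕ.+ a → n ℤ.+ 1ℤ ≡ n ℤ.- + suc a ℤ.+ + o ℤ.+ + k
    shift₀ o k eq = ≡.trans (≡.cong (ℤ._+ 1ℤ) (≡.sym (ℤ.+-identityʳ n))) (base-shift n a o k 0 eq)

    u≈ : r (2 ℕ.+ a) n ≈ u
    u≈ = r≈hankelDet (2 ℕ.+ a) 0 {n} (shift₀ 0 (2 ℕ.+ a) ≡.refl)

    p≈ : r (1 ℕ.+ a) n ≈ p
    p≈ = r≈hankelDet (1 ℕ.+ a) 1 {n} (shift₀ 1 (1 ℕ.+ a) ≡.refl)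

    q≈ : r (1 ℕ.+ a) (n ℤ.+ 1ℤ) ≈ q
    q≈ = r≈hankelDet (1 ℕ.+ a) 2 {n ℤ.+ 1ℤ} (base-shift n a 2 (1 ℕ.+ a) 1 ≡.refl)

    w≈ : r (2 ℕ.+ a) (n ℤ.+ 1ℤ) ≈ w
    w≈ = r≈hankelDet (2 ℕ.+ a) 1 {n ℤ.+ 1ℤ} (base-shift n a 1 (2 ℕ.+ a) 1 ≡.refl)

    u-cancel : ∀ {x} → x * u ≈ 0# → x ≈ 0#
    u-cancel eq = *-cancelʳ-# (r#0 (2 ℕ.+ a) n) (trans (trans (*-congˡ u≈) eq) (sym (zeroˡ _)))

    transport : ∀ {c₂ c₁ c₁′ c₀} →
      c (2 ℕ.+ a) (+ suc m) n ≈ c₂ → c (1 ℕ.+ a) (+ suc m) n ≈ c₁ →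
      c (1 ℕ.+ a) (+ m) n ≈ c₁′ → c a (+ m) n ≈ c₀ →
      c₂ * (p * q) ≈ c₁ * (u * q) + w * (c₁′ * p) + w * (c₀ * u) →
      c (2 ℕ.+ a) (+ suc m) n * (r (1 ℕ.+ a) n * r (1 ℕ.+ a) (n ℤ.+ 1ℤ)) ≈
        c (1 ℕ.+ a) (+ suc m) n * (r (2 ℕ.+ a) n * r (1 ℕ.+ a) (n ℤ.+ 1ℤ))
        + r (2 ℕ.+ a) (n ℤ.+ 1ℤ) * (c (1 ℕ.+ a) (+ m) n * r (1 ℕ.+ a) n)
        + r (2 ℕ.+ a) (n ℤ.+ 1ℤ) * (c a (+ m) n * r (2 ℕ.+ a) n)
    transport c₂≈ c₁≈ c₁′≈ c₀≈ eq = trans (*-cong c₂≈ (*-cong p≈ q≈)) (trans eq (sym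
      (+-cong (+-cong (*-cong c₁≈ (*-cong u≈ q≈)) (*-cong w≈ (*-cong c₁′≈ p≈))) (*-cong w≈ (*-cong c₀≈ u≈)))))

    split : ∃[ j ] toℕ {2 ℕ.+ a} j ℕ.+ m ≡ 1 ℕ.+ a → _
    -- Here `suc m = 2 + a`, so two of the `c` on the right are out of range and vanish.
    split (zero , m≡1+a) = transport
      (c≈minor (2 ℕ.+ a) 0 {n} zero (≡.cong suc m≡1+a) (shift₀ 0 (2 ℕ.+ a) ≡.refl))
      (c-above≈0 (1 ℕ.+ a) (suc m) n (ℕ.≤-reflexive (≡.cong suc (≡.sym m≡1+a))))
      (c≈minor (1 ℕ.+ a) 1 {n} zero m≡1+a (shift₀ 1 (1 ℕ.+ a) ≡.refl))
      (c-above≈0 a m n (ℕ.≤-reflexive (≡.sym m≡1+a)))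
      (trans (recurrence-zero u-cancel) (sym (trans
        (+-cong (trans (+-congʳ (zeroˡ _)) (+-identityˡ _)) (trans (*-congˡ (zeroˡ _)) (zeroʳ _)))
        (+-identityʳ _))))
    -- With `j + m = a`, the sizes `2 + a`, `1 + a`, `1 + a`, `a` at `m + 1`, `m + 1`, `m`, `m` omit
    -- the columns `j + 1`, `j`, `j + 1`, `j`.
    split (suc j , 1+j+m≡1+a) = transport
      (c≈minor (2 ℕ.+ a) 0 {n} (suc (inject₁ j)) (≡.cong suc inject₁j+1+m≡1+a) (shift₀ 0 (2 ℕ.+ a) ≡.refl))
      (c≈minor (1 ℕ.+ a) 1 {n} (inject₁ j) inject₁j+1+m≡1+a (shift₀ 1 (1 ℕ.+ a) ≡.refl))
      (c≈minor (1 ℕ.+ a) 1 {n} (suc j) 1+j+m≡1+a (shift₀ 1 (1 ℕ.+ a) ≡.refl))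
      (c≈minor a 2 {n} j (ℕ.suc-injective 1+j+m≡1+a) (shift₀ 2 a ≡.refl))
      (recurrence-suc u-cancel j)
      where
      inject₁j+1+m≡1+a : toℕ (inject₁ j) ℕ.+ suc m ≡ 1 ℕ.+ a
      inject₁j+1+m≡1+a = ≡.trans (≡.cong (ℕ._+ suc m) (toℕ-inject₁ j))
        (≡.trans (ℕ.+-suc (toℕ j) m) 1+j+m≡1+a)

-- From minors to normalised coefficients and weights.

module RecurrenceOfFractions {k ℓ₁ ℓ₂} (K : HeytingField k ℓ₁ ℓ₂)
    (r₁ : ℤ → HeytingField.Carrier K) (r#0 : Hankel.AllNonzero K r₁) where
  open HeytingField K using (_#_; heytingCommutativeRing)
  open HeytingCommutativeRing heytingCommutativeRing using (commutativeRing)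
  open CommutativeRing commutativeRing hiding (zero)
  open Hankel K r₁
  open HankelMinors K r₁
  open Weights K r₁ r#0
  open FieldProperties K
  open HCRProperties heytingCommutativeRing using (x#0y#0→xy#0)
  open SetoidReasoning setoid
  open Solver commutativeSemiring using (solve; _:+_; _:*_; _:=_)

  v*r≈r : ∀ α n → v (suc α) n * r α n ≈ r (suc α) n
  v*r≈r α n = /-cancel _ (r#0 α n)

  ∏v≈r : ∀ α n → ∏v α n ≈ r α n
  ∏v≈r zero    n = refl
  ∏v≈r (suc α) n = trans (*-congʳ (∏v≈r α n)) (trans (*-comm _ _) (v*r≈r α n))

  C*r≈c : ∀ α m n → C α m n * r α n ≈ c α m n
  C*r≈c α m n = trans (*-congˡ (sym (∏v≈r α n))) (/-cancel _ (∏v#0 α n))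

  -- Writing `r (suc α) n` as `v (suc α) n * r α n` exposes the denominator of the weight, which
  -- then cancels; the even weights go the same way.
  yOdd*r*r≈r*r : ∀ α n →
    yOdd (suc α) n * (r (suc α) n * r α (n ℤ.+ 1ℤ)) ≈ r (suc α) (n ℤ.+ 1ℤ) * r α n
  yOdd*r*r≈r*r α n = begin
    y * (r (suc α) n * r α n′)          ≈⟨ *-congˡ (*-congʳ (v*r≈r α n)) ⟨
    y * (v (suc α) n * r α n * r α n′)  ≈⟨ solve 4 (λ y v r r′ → y :* (v :* r :* r′) := y :* v :* r′ :* r) refl y _ _ _ ⟩
    y * v (suc α) n * r α n′ * r α n    ≈⟨ *-congʳ (*-congʳ (/-cancel _ (v#0 (suc α) n))) ⟩
    v (suc α) n′ * r α n′ * r α n       ≈⟨ *-congʳ (v*r≈r α n′) ⟩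
    r (suc α) n′ * r α n                ∎
    where
    n′ = n ℤ.+ 1ℤ
    y = yOdd (suc α) n

  yEven*r*r≈r*r : ∀ α n →
    yEven (suc α) n * (r (suc α) n * r (suc α) (n ℤ.+ 1ℤ)) ≈ r (2 ℕ.+ α) (n ℤ.+ 1ℤ) * r α n
  yEven*r*r≈r*r α n = begin
    y * (r (suc α) n * r (suc α) n′)          ≈⟨ *-congˡ (*-congʳ (v*r≈r α n)) ⟨
    y * (v (suc α) n * r α n * r (suc α) n′)  ≈⟨ solve 4 (λ y v r r′ → y :* (v :* r :* r′) := y :* v :* r′ :* r) refl y _ _ _ ⟩
    y * v (suc α) n * r (suc α) n′ * r α n    ≈⟨ *-congʳ (*-congʳ (/-cancel _ (v#0 (suc α) n))) ⟩
    v (2 ℕ.+ α) n′ * r (suc α) n′ * r α n     ≈⟨ *-congʳ (v*r≈r (suc α) n′) ⟩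
    r (2 ℕ.+ α) n′ * r α n                    ∎
    where
    n′ = n ℤ.+ 1ℤ
    y = yEven (suc α) n

  -- Both sides are compared after multiplication by `u * (p * q)`, which is apart from 0: `p`, `t`,
  -- `u` turn each `C` into `c`, while `u * q` and `p * q` clear the odd and the even weight.
  c-recurrence⇒C-recurrence : ∀ a m m′ n →
    c (2 ℕ.+ a) m n * (r (1 ℕ.+ a) n * r (1 ℕ.+ a) (n ℤ.+ 1ℤ)) ≈
      c (1 ℕ.+ a) m n * (r (2 ℕ.+ a) n * r (1 ℕ.+ a) (n ℤ.+ 1ℤ))
      + r (2 ℕ.+ a) (n ℤ.+ 1ℤ) * (c (1 ℕ.+ a) m′ n * r (1 ℕ.+ a) n)
      + r (2 ℕ.+ a) (n ℤ.+ 1ℤ) * (c a m′ n * r (2 ℕ.+ a) n) →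
    C (2 ℕ.+ a) m n ≈ C (1 ℕ.+ a) m n + yOdd (2 ℕ.+ a) n * C (1 ℕ.+ a) m′ n
                      + yEven (1 ℕ.+ a) n * C a m′ n
  c-recurrence⇒C-recurrence a m m′ n rec =
    *-cancelʳ-# (x#0y#0→xy#0 (r#0 (2 ℕ.+ a) n) (x#0y#0→xy#0 (r#0 (1 ℕ.+ a) n) (r#0 (1 ℕ.+ a) (n ℤ.+ 1ℤ)))) (begin
      C₂ * (u * (p * q))
        ≈⟨ *-assoc C₂ u (p * q) ⟨
      C₂ * u * (p * q)
        ≈⟨ *-congʳ (C*r≈c (2 ℕ.+ a) m n) ⟩
      c (2 ℕ.+ a) m n * (p * q)
        ≈⟨ rec ⟩
      c (1 ℕ.+ a) m n * (u * q) + w * (c (1 ℕ.+ a) m′ n * p) + w * (c a m′ n * u)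
        ≈⟨ +-cong (+-cong (*-congʳ (C*r≈c (1 ℕ.+ a) m n)) (*-congˡ (*-congʳ (C*r≈c (1 ℕ.+ a) m′ n))))
                  (*-congˡ (*-congʳ (C*r≈c a m′ n))) ⟨
      C₁ * p * (u * q) + w * (C₁′ * p * p) + w * (C₀ * t * u)
        ≈⟨ solve 8 (λ C₁ C₁′ C₀ p q u w t →
             C₁ :* p :* (u :* q) :+ w :* (C₁′ :* p :* p) :+ w :* (C₀ :* t :* u) :=
             C₁ :* p :* (u :* q) :+ (w :* p) :* (C₁′ :* p) :+ (w :* t) :* (C₀ :* u))
           refl C₁ C₁′ C₀ p q u w t ⟩
      C₁ * p * (u * q) + w * p * (C₁′ * p) + w * t * (C₀ * u)
        ≈⟨ +-cong (+-congˡ (*-congʳ (yOdd*r*r≈r*r (1 ℕ.+ a) n))) (*-congʳ (yEven*r*r≈r*r a n)) ⟨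
      C₁ * p * (u * q) + y * (u * q) * (C₁′ * p) + y′ * (p * q) * (C₀ * u)
        ≈⟨ solve 8 (λ C₁ C₁′ C₀ p q u y y′ →
             C₁ :* p :* (u :* q) :+ y :* (u :* q) :* (C₁′ :* p) :+ y′ :* (p :* q) :* (C₀ :* u) :=
             (C₁ :+ y :* C₁′ :+ y′ :* C₀) :* (u :* (p :* q)))
           refl C₁ C₁′ C₀ p q u y y′ ⟩
      (C₁ + y * C₁′ + y′ * C₀) * (u * (p * q)) ∎)
    where
    C₂  = C (2 ℕ.+ a) m n
    C₁  = C (1 ℕ.+ a) m n
    C₁′ = C (1 ℕ.+ a) m′ n
    C₀  = C a m′ n
    y   = yOdd (2 ℕ.+ a) n
    y′  = yEven (1 ℕ.+ a) n
    u   = r (2 ℕ.+ a) n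
    p   = r (1 ℕ.+ a) n
    q   = r (1 ℕ.+ a) (n ℤ.+ 1ℤ)
    w   = r (2 ℕ.+ a) (n ℤ.+ 1ℤ)
    t   = r a n

  C-zero≈1 : ∀ α n → C α (+ 0) n ≈ 1#
  C-zero≈1 α n = *-cancelʳ-# (r#0 α n) (begin
    C α (+ 0) n * r α n   ≈⟨ C*r≈c α (+ 0) n ⟩
    c α (+ 0) n           ≈⟨ c-zero≈r α n ⟩
    r α n                 ≈⟨ *-identityˡ _ ⟨
    1# * r α n            ∎)

  C-recurrence : ∀ a m → m ≤ 2 ℕ.+ a → ∀ n →
    C (2 ℕ.+ a) (+ m) n ≈ C (1 ℕ.+ a) (+ m) n + yOdd (2 ℕ.+ a) n * C (1 ℕ.+ a) (+ m ℤ.- 1ℤ) n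
                          + yEven (1 ℕ.+ a) n * C a (+ m ℤ.- 1ℤ) n
  -- At `m = 0` the index `m - 1` is negative, where `c` is `0#` by definition; the two remaining
  -- terms are both 1.
  C-recurrence a zero    m≤2+a n = begin
    C (2 ℕ.+ a) (+ 0) n
      ≈⟨ trans (C-zero≈1 (2 ℕ.+ a) n) (sym (C-zero≈1 (1 ℕ.+ a) n)) ⟩
    C (1 ℕ.+ a) (+ 0) n
      ≈⟨ trans (+-cong (trans (+-congˡ (vanish (1 ℕ.+ a))) (+-identityʳ _)) (vanish a)) (+-identityʳ _) ⟨
    C (1 ℕ.+ a) (+ 0) n + yOdd (2 ℕ.+ a) n * C (1 ℕ.+ a) ℤ.-1ℤ n + yEven (1 ℕ.+ a) n * C a ℤ.-1ℤ n ∎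
    where
    vanish : ∀ α {y} → y * C α ℤ.-1ℤ n ≈ 0#
    vanish α = trans (*-congˡ (zeroˡ _)) (zeroʳ _)
  C-recurrence a (suc m) m≤2+a n =
    c-recurrence⇒C-recurrence a (+ suc m) (+ m) n (c-recurrence r#0 a m n (ℕ.s≤s⁻¹ m≤2+a))

mainTheorem5 : ∀ {k ℓ₁ ℓ₂} (K : HeytingField k ℓ₁ ℓ₂) (let open HeytingField K)
    (r₁ : ℤ → Carrier) (let open Hankel K r₁ using (r))
    (r#0 : ∀ α n → r α n # 0#) (let open Weights K r₁ r#0) →
    (∀ (a : ℕ) (let α = 2 ℕ.+ a) (m : ℕ) → m ≤ α → (n : ℤ) →
    C α (+ m) n ≈
    C (α ∸ 1) (+ m) n
    + yOdd α n * C (α ∸ 1) (+ m ℤ.- 1ℤ) n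
    + yEven (α ∸ 1) n * C (α ∸ 2) (+ m ℤ.- 1ℤ) n)
    × (∀ (α : ℕ) (n : ℤ) → C α (+ 0) n ≈ 1#)
mainTheorem5 K r₁ r#0 = C-recurrence , C-zero≈1
  where open RecurrenceOfFractions K r₁ r#0
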